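{- For each of the following sets $T$ of five generalized patterns there is an integer $k$ such that $|S_n(T)|=0$ for every $n\ge k$. Here $T=Q\cup\{r\}$ with: (1) $Q=\{1\text{ - }23,2\text{ - }13,3\text{ - }21,12\text{ - }3\}$, $r\in\{21\text{ - }3,2\text{ - }31,23\text{ - }1,1\text{ - }32,13\text{ - }2,3\text{ - }12,31\text{ - }2,32\text{ - }1\}$; (2) $Q=\{1\text{ - }23,2\text{ - }13,3\text{ - }21,21\text{ - }3\}$, $r\in\{2\text{ - }31,23\text{ - }1,1\text{ - }32,13\text{ - }2,3\text{ - }12,31\text{ - }2\}$; (3) $Q=\{1\text{ - }23,2\text{ - }13,32\text{ - }1,12\text{ - }3\}$, $r\in\{21\text{ - }3,2\text{ - }31,23\text{ - }1,1\text{ - }32,3\text{ - }12,31\text{ - }2\}$; (4) $Q=\{1\text{ - }23,2\text{ - }13,32\text{ - }1,21\text{ - }3\}$, $r\in\{2\text{ - }31,23\text{ - }1,1\text{ - }32,13\text{ - }2,3\text{ - }12,31\text{ - }2\}$; (5) $Q=\{1\text{ - }23,2\text{ - }13,3\text{ - }21,23\text{ - }1\}$, $r\in\{1\text{ - }32,13\text{ - }2,3\text{ - }12,31\text{ - }2,32\text{ - }1\}$; (6) $Q=\{1\text{ - }23,2\text{ - }13,32\text{ - }1,2\text{ - }31\}$, $r\in\{23\text{ - }1,1\text{ - }32,13\text{ - }2,31\text{ - }2,3\text{ - }12\}$; (7) $Q=\{1\text{ - }23,21\text{ - }3,3\text{ - }21,1\text{ - }32\}$, $r\in\{12\text{ -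 }3,32\text{ - }1,13\text{ - }2,3\text{ - }12,31\text{ - }2\}$; (8) $Q=\{1\text{ - }23,21\text{ - }3,32\text{ - }1,2\text{ - }31\}$, $r\in\{3\text{ - }12,13\text{ - }2,1\text{ - }32,23\text{ - }1,12\text{ - }3\}$; (9) $Q=\{1\text{ - }23,23\text{ - }1,32\text{ - }1,2\text{ - }13\}$, $r\in\{1\text{ - }32,13\text{ - }2,3\text{ - }12,31\text{ - }2\}$; (10) $Q=\{1\text{ - }23,2\text{ - }13,3\text{ - }21,1\text{ - }32\}$, $r\in\{13\text{ - }2,3\text{ - }12,31\text{ - }2\}$; (11) $Q=\{1\text{ - }23,23\text{ - }1,32\text{ - }1,12\text{ - }3\}$, $r\in\{1\text{ - }32,2\text{ - }31,31\text{ - }2\}$; (12) $Q=\{1\text{ - }23,21\text{ - }3,3\text{ - }21,31\text{ - }2\}$, $r\in\{12\text{ - }3,13\text{ - }2,3\text{ - }12\}$; (13) $Q=\{1\text{ - }23,21\text{ - }3,3\text{ - }21,23\text{ - }1\}$, $r\in\{1\text{ - }32,13\text{ - }2,32\text{ - }1\}$; (14) $Q=\{1\text{ - }23,21\text{ - }3,32\text{ - }1,13\text{ - }2\}$, $r\in\{3\text{ - }21,23\text{ - }1,1\text{ - }32\}$; (15) $Q=\{1\text{ - }23,2\text{ - }13,3\text{ - }21,13\text{ - }2\}$, $r\in\{3\text{ - }12,31\text{ - }2\}$; (16) $Q=\{1\text{ - }23,2\text{ - }13,3\text{ - }21,2\text{ - }31\}$, $r\in\{1\text{ - }32,13\text{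 - }2\}$; (17) $Q=\{1\text{ - }23,2\text{ - }13,3\text{ - }21,32\text{ - }1\}$, $r\in\{13\text{ - }2,3\text{ - }12\}$; (18) $Q=\{1\text{ - }23,23\text{ - }1,32\text{ - }1,1\text{ - }32\}$, $r\in\{21\text{ - }3,13\text{ - }2\}$; (19) $Q=\{1\text{ - }23,2\text{ - }13,32\text{ - }1,13\text{ - }2\}$, $r\in\{1\text{ - }32,3\text{ - }12\}$; (20) $Q=\{1\text{ - }23,12\text{ - }3,3\text{ - }21,1\text{ - }32\}$, $r\in\{3\text{ - }12,23\text{ - }1\}$; (21) $Q=\{1\text{ - }23,12\text{ - }3,3\text{ - }21,23\text{ - }1\}$, $r\in\{2\text{ - }31,32\text{ - }1\}$; (22) $Q=\{1\text{ - }23,2\text{ - }13,3\text{ - }21,31\text{ - }2\}$, $r=3\text{ - }12$; (23) $Q=\{1\text{ - }23,23\text{ - }1,32\text{ - }1,13\text{ - }2\}$, $r=2\text{ - }31$; (24) $Q=\{1\text{ - }23,2\text{ - }13,32\text{ - }1,3\text{ - }12\}$, $r=1\text{ - }32$; (25) $Q=\{1\text{ - }23,21\text{ - }3,3\text{ - }21,13\text{ - }2\}$, $r=3\text{ - }12$; (26) $Q=\{1\text{ - }23,21\text{ - }3,32\text{ - }1,3\text{ - }12\}$, $r=23\text{ - }1$.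
   Context: $S_n$ is the set of permutations $\pi=\pi_1\pi_2\cdots\pi_n$ of $\{1,\dots,n\}$. For $abc$ a permutation of $123$, the generalized pattern $a\text{ - }bc$ is contained in $\pi$ if there are indices $i<j$ with $j+1\le n$ such that $\pi_i\pi_j\pi_{j+1}$ is order-isomorphic to $abc$; the generalized pattern $ab\text{ - }c$ is contained in $\pi$ if there are indices $i,k$ with $i+1<k\le n$ such that $\pi_i\pi_{i+1}\pi_k$ is order-isomorphic to $abc$. (Letters not separated by a dash must occur in adjacent positions; letters separated by a dash need not be adjacent.) $\pi$ avoids a pattern if it does not contain it. For a set $T$ of generalized patterns, $S_n(T)$ is the set of $\pi\in S_n$ avoiding every pattern in $T$. -}

module Defs where

open import Data.Fin.Base using (Fin; toℕ)
open import Data.Fin.Permutation using (Permutation′; _⟨$⟩ʳ_)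
open import Data.List.Base using (List; []; _∷_)
open import Data.List.Relation.Unary.All using (All)
open import Data.Nat.Base using (ℕ; suc; _<_)
open import Data.Product.Base using (Σ; _×_; _,_)
open import Data.Vec.Base using (Vec; []; _∷_; lookup)
open import Function.Bundles using (_⇔_; Inverse)
open import Level using (0ℓ)
open import Relation.Binary.Bundles using (Setoid)
open import Relation.Binary.Construct.On as On using ()
open import Relation.Binary.PropositionalEquality using (_≡_; _→-setoid_; setoid)
open import Relation.Nullary.Negation using (¬_)

OrderIsomorphic : ∀ {m} → Vec ℕ m → Vec ℕ m → Set
OrderIsomorphic {m} u v =
  (p q : Fin m) → (lookup u p < lookup u q) ⇔ (lookup v p < lookup v q)

-- The constructor name shows the position of the dash; the word is abc. The
-- type admits any word of three letters, but only permutations of 123 occur.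
data GenPattern : Set where
  a-bc : Vec ℕ 3 → GenPattern
  ab-c : Vec ℕ 3 → GenPattern

-- Positions and letters of a permutation are numbered from 0, those of a
-- pattern from 1; only the relative order of letters is ever compared.
_Contains_ : ∀ {n} → Permutation′ n → GenPattern → Set
_Contains_ {n} π (a-bc w) =
  Σ (Fin n) λ i → Σ (Fin n) λ j → Σ (Fin n) λ j′ →
    toℕ i < toℕ j ×
    toℕ j′ ≡ suc (toℕ j) ×
    OrderIsomorphic (letter i ∷ letter j ∷ letter j′ ∷ []) w
  where
  letter : Fin n → ℕ
  letter x = toℕ (π ⟨$⟩ʳ x)
_Contains_ {n} π (ab-c w) =
  Σ (Fin n) λ i → Σ (Fin n) λ i′ → Σ (Fin n) λ k →
    toℕ i′ ≡ suc (toℕ i) ×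
    toℕ i′ < toℕ k ×
    OrderIsomorphic (letter i ∷ letter i′ ∷ letter k ∷ []) w
  where
  letter : Fin n → ℕ
  letter x = toℕ (π ⟨$⟩ʳ x)

_Avoids_ : ∀ {n} → Permutation′ n → GenPattern → Set
π Avoids p = ¬ (π Contains p)

-- Two elements are identified when their permutations agree as functions,
-- whatever the inverses and the proofs of avoidance.
S : ℕ → List GenPattern → Setoid 0ℓ 0ℓ
S n T = On.setoid {B = Σ (Permutation′ n) λ π → All (π Avoids_) T}
                  (Fin n →-setoid Fin n)
                  (λ (π , _) → π ⟨$⟩ʳ_)

∣_∣≡_ : Setoid 0ℓ 0ℓ → ℕ → Set
∣ X ∣≡ m = Inverse X (setoid (Fin m))

1-23 1-32 2-13 2-31 3-12 3-21 : GenPattern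
1-23 = a-bc (1 ∷ 2 ∷ 3 ∷ [])
1-32 = a-bc (1 ∷ 3 ∷ 2 ∷ [])
2-13 = a-bc (2 ∷ 1 ∷ 3 ∷ [])
2-31 = a-bc (2 ∷ 3 ∷ 1 ∷ [])
3-12 = a-bc (3 ∷ 1 ∷ 2 ∷ [])
3-21 = a-bc (3 ∷ 2 ∷ 1 ∷ [])

12-3 13-2 21-3 23-1 31-2 32-1 : GenPattern
12-3 = ab-c (1 ∷ 2 ∷ 3 ∷ [])
13-2 = ab-c (1 ∷ 3 ∷ 2 ∷ [])
21-3 = ab-c (2 ∷ 1 ∷ 3 ∷ [])
23-1 = ab-c (2 ∷ 3 ∷ 1 ∷ [])
31-2 = ab-c (3 ∷ 1 ∷ 2 ∷ [])
32-1 = ab-c (3 ∷ 2 ∷ 1 ∷ [])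

-- Each entry (Q , R) stands for the sets T = Q ∪ {r} with r ∈ R.
families : List (List GenPattern × List GenPattern)
families =
  (1-23 ∷ 2-13 ∷ 3-21 ∷ 12-3 ∷ [] , 21-3 ∷ 2-31 ∷ 23-1 ∷ 1-32 ∷ 13-2 ∷ 3-12 ∷ 31-2 ∷ 32-1 ∷ []) ∷
  (1-23 ∷ 2-13 ∷ 3-21 ∷ 21-3 ∷ [] , 2-31 ∷ 23-1 ∷ 1-32 ∷ 13-2 ∷ 3-12 ∷ 31-2 ∷ []) ∷
  (1-23 ∷ 2-13 ∷ 32-1 ∷ 12-3 ∷ [] , 21-3 ∷ 2-31 ∷ 23-1 ∷ 1-32 ∷ 3-12 ∷ 31-2 ∷ []) ∷
  (1-23 ∷ 2-13 ∷ 32-1 ∷ 21-3 ∷ [] , 2-31 ∷ 23-1 ∷ 1-32 ∷ 13-2 ∷ 3-12 ∷ 31-2 ∷ []) ∷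
  (1-23 ∷ 2-13 ∷ 3-21 ∷ 23-1 ∷ [] , 1-32 ∷ 13-2 ∷ 3-12 ∷ 31-2 ∷ 32-1 ∷ []) ∷
  (1-23 ∷ 2-13 ∷ 32-1 ∷ 2-31 ∷ [] , 23-1 ∷ 1-32 ∷ 13-2 ∷ 31-2 ∷ 3-12 ∷ []) ∷
  (1-23 ∷ 21-3 ∷ 3-21 ∷ 1-32 ∷ [] , 12-3 ∷ 32-1 ∷ 13-2 ∷ 3-12 ∷ 31-2 ∷ []) ∷
  (1-23 ∷ 21-3 ∷ 32-1 ∷ 2-31 ∷ [] , 3-12 ∷ 13-2 ∷ 1-32 ∷ 23-1 ∷ 12-3 ∷ []) ∷
  (1-23 ∷ 23-1 ∷ 32-1 ∷ 2-13 ∷ [] , 1-32 ∷ 13-2 ∷ 3-12 ∷ 31-2 ∷ []) ∷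
  (1-23 ∷ 2-13 ∷ 3-21 ∷ 1-32 ∷ [] , 13-2 ∷ 3-12 ∷ 31-2 ∷ []) ∷
  (1-23 ∷ 23-1 ∷ 32-1 ∷ 12-3 ∷ [] , 1-32 ∷ 2-31 ∷ 31-2 ∷ []) ∷
  (1-23 ∷ 21-3 ∷ 3-21 ∷ 31-2 ∷ [] , 12-3 ∷ 13-2 ∷ 3-12 ∷ []) ∷
  (1-23 ∷ 21-3 ∷ 3-21 ∷ 23-1 ∷ [] , 1-32 ∷ 13-2 ∷ 32-1 ∷ []) ∷
  (1-23 ∷ 21-3 ∷ 32-1 ∷ 13-2 ∷ [] , 3-21 ∷ 23-1 ∷ 1-32 ∷ []) ∷
  (1-23 ∷ 2-13 ∷ 3-21 ∷ 13-2 ∷ [] , 3-12 ∷ 31-2 ∷ []) ∷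
  (1-23 ∷ 2-13 ∷ 3-21 ∷ 2-31 ∷ [] , 1-32 ∷ 13-2 ∷ []) ∷
  (1-23 ∷ 2-13 ∷ 3-21 ∷ 32-1 ∷ [] , 13-2 ∷ 3-12 ∷ []) ∷
  (1-23 ∷ 23-1 ∷ 32-1 ∷ 1-32 ∷ [] , 21-3 ∷ 13-2 ∷ []) ∷
  (1-23 ∷ 2-13 ∷ 32-1 ∷ 13-2 ∷ [] , 1-32 ∷ 3-12 ∷ []) ∷
  (1-23 ∷ 12-3 ∷ 3-21 ∷ 1-32 ∷ [] , 3-12 ∷ 23-1 ∷ []) ∷
  (1-23 ∷ 12-3 ∷ 3-21 ∷ 23-1 ∷ [] , 2-31 ∷ 32-1 ∷ []) ∷
  (1-23 ∷ 2-13 ∷ 3-21 ∷ 31-2 ∷ [] , 3-12 ∷ []) ∷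
  (1-23 ∷ 23-1 ∷ 32-1 ∷ 13-2 ∷ [] , 2-31 ∷ []) ∷
  (1-23 ∷ 2-13 ∷ 32-1 ∷ 3-12 ∷ [] , 1-32 ∷ []) ∷
  (1-23 ∷ 21-3 ∷ 3-21 ∷ 13-2 ∷ [] , 3-12 ∷ []) ∷
  (1-23 ∷ 21-3 ∷ 32-1 ∷ 3-12 ∷ [] , 23-1 ∷ []) ∷
  []

{-# OPTIONS --safe #-}

-- Deleting the first letter of a permutation that avoids T leaves, after
-- relabelling, one that avoids T. So the avoiders of length n + 1 are found
-- among the insertions of a first letter into the avoiders of length n, and
-- once there is none of some length there is none of any greater length.
-- For every T of the theorem this happens by length 6, which is computed.
module Submission where

open import Defs
open import Data.Fin.Base using (Fin; zero; suc; toℕ; punchIn)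
open import Data.Fin.Patterns using (0F)
open import Data.Fin.Permutation
  using (Permutation′; _⟨$⟩ʳ_; _≈_; id; insert; remove; punchIn-permute)
import Data.Fin.Properties as Fin
open import Data.List.Base using (List; []; _∷_; _∷ʳ_; allFin; cartesianProductWith; filter)
open import Data.List.Membership.Propositional using (_∈_)
open import Data.List.Membership.Propositional.Properties using (∈-allFin)
open import Data.List.Membership.Setoid.Properties using (∈-filter⁺)
open import Data.List.Properties using (cartesianProductWith-zeroʳ)
open import Data.List.Relation.Unary.All as All using (All)
open import Data.List.Relation.Unary.Any using (Any; here)
open import Data.List.Relation.Unary.Any.Properties using (cartesianProductWith⁺)
open import Data.Nat.Base using (ℕ; zero; suc; _+_; _<_; _≥_; s<s)
open import Data.Nat.Properties using (_≟_; _<?_; <⇒≱; ≰⇒>; m∸n+n≡m)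
open import Data.Product.Base using (∃; _×_; _,_)
open import Data.Vec.Base using (Vec; []; _∷_; lookup; map)
open import Data.Vec.Properties using (lookup-map)
open import Function.Base using (_∘_)
open import Function.Bundles using (_⇔_; mk⇔; Equivalence)
open import Function.Construct.Composition using (_⇔-∘_)
open import Function.Construct.Symmetry using (⇔-sym)
open import Relation.Binary.Bundles using (Setoid)
import Relation.Binary.Construct.On as On
open import Relation.Binary.PropositionalEquality
  using (_≡_; refl; sym; trans; cong; subst; subst₂; _→-setoid_; module ≡-Reasoning)
open import Relation.Nullary.Decidable
  using (Dec; yes; no; map′; _×-dec_; _→-dec_; ¬?; from-yes)
open import Relation.Nullary.Negation using (¬_; contradiction)
open import Relation.Unary using (Decidable)

private
  variable
    m n k : ℕ
    T : List GenPattern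

_⇔-dec_ : ∀ {A B : Set} → Dec A → Dec B → Dec (A ⇔ B)
a? ⇔-dec b? = map′ (λ (f , g) → mk⇔ f g) (λ e → Equivalence.to e , Equivalence.from e)
                   ((a? →-dec b?) ×-dec (b? →-dec a?))

orderIsomorphic? : (u v : Vec ℕ k) → Dec (OrderIsomorphic u v)
orderIsomorphic? u v = Fin.all? λ p → Fin.all? λ q →
  (lookup u p <? lookup u q) ⇔-dec (lookup v p <? lookup v q)

letter : Permutation′ n → Fin n → ℕ
letter π i = toℕ (π ⟨$⟩ʳ i)

-- On explicit indices `map (letter π)` reduces to the vector of letters in `_Contains_`. The
-- conditions on positions come first, so letters are compared only where these hold.
_contains?_ : (π : Permutation′ n) (p : GenPattern) → Dec (π Contains p)
π contains? (a-bc w) = Fin.any? λ i → Fin.any? λ j → Fin.any? λ j′ →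
  (toℕ i <? toℕ j) ×-dec (toℕ j′ ≟ suc (toℕ j)) ×-dec
  orderIsomorphic? (map (letter π) (i ∷ j ∷ j′ ∷ [])) w
π contains? (ab-c w) = Fin.any? λ i → Fin.any? λ i′ → Fin.any? λ k →
  (toℕ i′ ≟ suc (toℕ i)) ×-dec (toℕ i′ <? toℕ k) ×-dec
  orderIsomorphic? (map (letter π) (i ∷ i′ ∷ k ∷ [])) w

avoidsAll? : (T : List GenPattern) → Decidable (λ (π : Permutation′ n) → All (π Avoids_) T)
avoidsAll? T π = All.all? (λ p → ¬? (π contains? p)) T

orderIsomorphic-map : ∀ {A : Set} (f g : A → ℕ) → (∀ x y → (f x < f y) ⇔ (g x < g y)) →
  (xs : Vec A k) {v : Vec ℕ k} → OrderIsomorphic (map f xs) v → OrderIsomorphic (map g xs) v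
orderIsomorphic-map f g f⇔g xs {v} iso p q =
  subst₂ (λ a b → (a < b) ⇔ (lookup v p < lookup v q))
    (sym (lookup-map p g xs)) (sym (lookup-map q g xs))
    (subst₂ (λ a b → (a < b) ⇔ (lookup v p < lookup v q))
       (lookup-map p f xs) (lookup-map q f xs) (iso p q)
     ⇔-∘ ⇔-sym (f⇔g (lookup xs p) (lookup xs q)))

module _ (π : Permutation′ m) (ρ : Permutation′ n) (e : Fin m → Fin n)
         (mono : ∀ {i j} → toℕ i < toℕ j → toℕ (e i) < toℕ (e j))
         (adjacent : ∀ {i j} → toℕ j ≡ suc (toℕ i) → toℕ (e j) ≡ suc (toℕ (e i)))
         (order : ∀ i j → (letter π i < letter π j) ⇔ (letter ρ (e i) < letter ρ (e j))) where

  -- Serves two embeddings: `suc`, for deleting the first letter, and the identity, for replacing a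
  -- permutation by a pointwise equal one. Undashed letters are why adjacency has to be preserved.
  contains-embed : ∀ {p} → π Contains p → ρ Contains p
  contains-embed {a-bc w} (i , j , j′ , i<j , adj , iso) =
    e i , e j , e j′ , mono i<j , adjacent adj ,
    orderIsomorphic-map (letter π) (letter ρ ∘ e) order (i ∷ j ∷ j′ ∷ []) {w} iso
  contains-embed {ab-c w} (i , i′ , k , adj , i′<k , iso) =
    e i , e i′ , e k , adjacent adj , mono i′<k ,
    orderIsomorphic-map (letter π) (letter ρ ∘ e) order (i ∷ i′ ∷ k ∷ []) {w} iso

contains-resp-≈ : ∀ {π ρ : Permutation′ n} {p} → π ≈ ρ → π Contains p → ρ Contains p
contains-resp-≈ {π = π} {ρ} π≈ρ = contains-embed π ρ (λ i → i) (λ i<j → i<j) (λ adj → adj) λ i j →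
  mk⇔ (subst₂ (λ a b → toℕ a < toℕ b) (π≈ρ i) (π≈ρ j))
      (subst₂ (λ a b → toℕ a < toℕ b) (sym (π≈ρ i)) (sym (π≈ρ j)))

-- Each direction is the contrapositive of a fact about `≤`, with `i` and `j` exchanged.
punchIn-<-⇔ : ∀ (v : Fin (suc n)) i j → (toℕ i < toℕ j) ⇔ (toℕ (punchIn v i) < toℕ (punchIn v j))
punchIn-<-⇔ v i j = mk⇔
  (λ i<j → ≰⇒> (<⇒≱ i<j ∘ Fin.punchIn-cancel-≤ v j i))
  (λ i<j → ≰⇒> (<⇒≱ i<j ∘ Fin.punchIn-mono-≤ v j i))

-- Deleting an inner letter could create new adjacencies; deleting the first cannot. The remaining
-- letters are relabelled by undoing `punchIn` around the deleted one, which keeps their order.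
contains-remove : ∀ (ρ : Permutation′ (suc n)) {p} → remove 0F ρ Contains p → ρ Contains p
contains-remove ρ = contains-embed (remove 0F ρ) ρ suc s<s (cong suc) λ i j →
  subst₂ (λ a b → (letter (remove 0F ρ) i < letter (remove 0F ρ) j) ⇔ (toℕ a < toℕ b))
    (sym (punchIn-permute ρ 0F i)) (sym (punchIn-permute ρ 0F j))
    (punchIn-<-⇔ (ρ ⟨$⟩ʳ 0F) _ _)

≈-setoid : ℕ → Setoid _ _
≈-setoid n = On.setoid (Fin n →-setoid Fin n) (_⟨$⟩ʳ_ {n} {n})

-- Filtering at every length, not only at the last, keeps the lists short enough to compute.
avoiders : List GenPattern → ∀ n → List (Permutation′ n)
avoiders T zero    = id ∷ []
avoiders T (suc n) =
  filter (avoidsAll? T) (cartesianProductWith (insert 0F) (allFin (suc n)) (avoiders T n))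

avoiders-complete : ∀ (ρ : Permutation′ n) → All (ρ Avoids_) T → Any (ρ ≈_) (avoiders T n)
avoiders-complete {zero}  ρ av = here λ ()
avoiders-complete {suc n} {T} ρ av = ∈-filter⁺ (≈-setoid (suc n)) (avoidsAll? T)
  -- Avoidance passes from `π` to `σ` because containment passes back from `σ` to `π`, hence the
  -- `sym`.
  (λ π≈σ → All.map (_∘ contains-resp-≈ (sym ∘ π≈σ)))
  (cartesianProductWith⁺ (insert 0F) reinsert (∈-allFin (ρ ⟨$⟩ʳ 0F))
    (avoiders-complete (remove 0F ρ) (All.map (_∘ contains-remove ρ) av)))
  av
  where
  -- Putting the first letter of `ρ` back in front of what remains recovers `ρ` as a function, hence
  -- only up to `≈`.
  reinsert : ∀ {v π} → ρ ⟨$⟩ʳ 0F ≡ v → remove 0F ρ ≈ π → ρ ≈ insert 0F v π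
  reinsert refl r≈π zero    = refl
  reinsert refl r≈π (suc i) =
    trans (punchIn-permute ρ 0F i) (cong (punchIn (ρ ⟨$⟩ʳ 0F)) (r≈π i))

-- With nothing to insert a letter into, there are no candidates at the next length.
avoiders-stay-[] : ∀ d → avoiders T k ≡ [] → avoiders T (d + k) ≡ []
avoiders-stay-[] zero    eq = eq
avoiders-stay-[] {T} {k} (suc d) eq = begin
  filter (avoidsAll? T) (cartesianProductWith (insert 0F) (allFin (suc d + k)) (avoiders T (d + k)))
    ≡⟨ cong (filter (avoidsAll? T) ∘ cartesianProductWith (insert 0F) (allFin (suc d + k)))
            (avoiders-stay-[] d eq) ⟩
  filter (avoidsAll? T) (cartesianProductWith (insert 0F) (allFin (suc d + k)) [])
    ≡⟨ cong (filter (avoidsAll? T)) (cartesianProductWith-zeroʳ (insert 0F) (allFin (suc d + k))) ⟩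
  []  ∎
  where open ≡-Reasoning

none-avoid : avoiders T k ≡ [] → n ≥ k → (π : Permutation′ n) → ¬ All (π Avoids_) T
none-avoid {T} {k} {n} eq n≥k π av =
  contradiction (subst (Any (π ≈_)) avoiders≡[] (avoiders-complete π av)) λ ()
  where
  avoiders≡[] : avoiders T n ≡ []
  avoiders≡[] = subst (λ l → avoiders T l ≡ []) (m∸n+n≡m n≥k) (avoiders-stay-[] _ eq)

empty⇒∣∣≡0 : ∀ {X : Setoid _ _} → ¬ Setoid.Carrier X → ∣ X ∣≡ 0
empty⇒∣∣≡0 ¬X = record
  { to        = λ x → contradiction x ¬X
  ; from      = λ ()
  ; to-cong   = λ {x} _ → contradiction x ¬X
  ; from-cong = λ { {()} }
  ; inverse   = (λ { {()} }) , (λ {x} _ → contradiction x ¬X)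
  }

null? : ∀ {A : Set} → Decidable {A = List A} (_≡ [])
null? []      = yes refl
null? (_ ∷ _) = no λ ()

AvoidersEnd : ℕ → List GenPattern × List GenPattern → Set
AvoidersEnd k (Q , R) = All (λ r → avoiders (Q ∷ʳ r) k ≡ []) R

avoidersEnd? : ∀ k → Decidable (AvoidersEnd k)
avoidersEnd? k (Q , R) = All.all? (λ r → null? (avoiders (Q ∷ʳ r) k)) R

-- Holds by evaluation: the type checker runs the search for every `T`. The single length 6 serves
-- them all.
families-end : All (AvoidersEnd 6) families
families-end = from-yes (All.all? (avoidersEnd? 6) families)

mainTheorem13 : ∀ {Q R : List GenPattern} {r : GenPattern} → (Q , R) ∈ families → r ∈ R →
    ∃ λ (k : ℕ) → ∀ (n : ℕ) → n ≥ k → ∣ S n (Q ∷ʳ r) ∣≡ 0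
mainTheorem13 QR∈ r∈R = 6 , λ n n≥6 →
  empty⇒∣∣≡0 λ (π , av) → none-avoid (All.lookup (All.lookup families-end QR∈) r∈R) n≥6 π av
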